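{- Let a product two-action game with $m$ players be given and let $\pi\in S_m$ have exactly one fixed point. Then $EC(\pi)$ has exactly two elements, and exactly one of them is a Nash equilibrium.
   Context: Fix an integer $m\ge 1$ and $\mathcal A=\{1,\dots,m\}$. A two-action game is a finite game in normal form with player set $\mathcal A$ in which each player $i$ has exactly two pure strategies $s^i_0,s^i_1$, together with utility functions $U^i:S\to\mathbb R$, where $S=\prod_{i\in\mathcal A}\{s^i_0,s^i_1\}$. A mixed strategy combination is identified with $\underline\gamma=(\gamma^1,\dots,\gamma^m)\in[0,1]^m$, where $\gamma^i$ is the probability with which player $i$ plays $s^i_1$. The expected utility $V^i$ is the multilinear extension $V^i(\underline\gamma)=\sum_{(j_1,\dots,j_m)\in\{0,1\}^m}\prod_{k=1}^m p_k(j_k)\,U^i(s^1_{j_1},\dots,s^m_{j_m})$ with $p_k(1)=\gamma^k$, $p_k(0)=1-\gamma^k$. Write $\underline\gamma^{ -i}=(\gamma^j)_{j\ne i}$ and $\lambda^i(\underline\gamma^{ -i}):=V^i(\underline\gamma)|_{\gamma^i=1}-V^i(\underline\gamma)|_{\gamma^i=0}$. A Nash equilibrium is a point $\underline\gamma\in[0,1]^m$ such that for every $i$: $\lambda^i(\underline\gamma^{ -i})=0$ if $0<\gamma^i<1$; $\lambda^i(\underline\gamma^{ -i})\le 0$ if $\gamma^i=0$; $\lambda^i(\underline\gamma^{ -i})\ge 0$ if $\gamma^i=1$. For $\underline\gamma$ put $L(\underline\gamma)=\{i:\gamma^i\in\{0,1\}\}$. A two-action game is a product two-action game if there exist $\underline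 v=(v_1,\dots,v_m)\in\{0,1\}^m$ and numbers $a^i_j\in(0,1)$ for $i,j\in\mathcal A$, $i\ne j$, with $a^{i_1}_j\neq a^{i_2}_j$ whenever $i_1\neq i_2$ and both differ from $j$, such that $\lambda^i(\underline\gamma^{ -i})=(-1)^{v_i}\prod_{j\in\mathcal A\setminus\{i\}}(\gamma^j-a^i_j)$ for every $i\in\mathcal A$. For $\pi\in S_m$, $F(\pi)=\{i\in\mathcal A:\pi(i)=i\}$ and $EC(\pi):=\{\underline\gamma\in[0,1]^m \mid L(\underline\gamma)=F(\pi),\ \gamma^j=a^{\pi(j)}_j \text{ for all } j\notin F(\pi)\}$. -}

module Defs where

open import Level using (Level; _⊔_) renaming (suc to lsuc)
open import Algebra.Apartness.Bundles using (HeytingField; HeytingCommutativeRing)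
open import Algebra.Bundles using (CommutativeRing; Semiring)
import Algebra.Definitions.RawSemiring as RawSemiringDefs
open import Data.Fin.Base using (Fin; zero; suc; toℕ)
open import Data.Fin.Permutation using (Permutation′; _⟨$⟩ʳ_)
open import Data.Nat.Base as ℕ using (ℕ; zero; suc)
open import Data.Product.Base using (_×_; ∃; ∃-syntax)
open import Data.Product using (∃!)
open import Data.Sum.Base using (_⊎_)
open import Data.Vec.Base using (Vec; []; _∷_; lookup)
open import Data.Vec.Functional using (Vector; insertAt; removeAt)
open import Function.Bundles using (_⇔_)
open import Relation.Binary.Core using (Rel)
open import Relation.Binary.PropositionalEquality.Core using (_≡_; _≢_)
open import Relation.Binary.Structures using (IsStrictPartialOrder)
open import Relation.Nullary.Negation.Core using (¬_)

-- ℝ, axiomatised as a Cauchy-complete Archimedean ordered field.  Classically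
-- these axioms determine ℝ up to isomorphism; they do not assume a decidable
-- order, so the constructive Cauchy reals satisfy them too.  "Distinct" reals
-- are apart (_#_), and x ≤ y means that y < x is impossible.
record Reals (c ℓ₁ ℓ₂ ℓ₃ : Level) : Set (lsuc (c ⊔ ℓ₁ ⊔ ℓ₂ ⊔ ℓ₃)) where
  infix 4 _<_ _≤_
  field
    heytingField : HeytingField c ℓ₁ ℓ₂

  open HeytingField heytingField public

  commutativeRing : CommutativeRing c ℓ₁
  commutativeRing = HeytingCommutativeRing.commutativeRing heytingCommutativeRing

  open RawSemiringDefs (Semiring.rawSemiring (CommutativeRing.semiring commutativeRing)) public
    using (product; _^_) renaming (_×_ to _·_)

  field
    _<_                  : Rel Carrier ℓ₃
    isStrictPartialOrder : IsStrictPartialOrder _≈_ _<_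
    #⇔<⊎>                : ∀ x y → (x # y) ⇔ (x < y ⊎ y < x)
    +-monoˡ-<            : ∀ {x y} z → x < y → x + z < y + z
    *-pos                : ∀ {x y} → 0# < x → 0# < y → 0# < x * y
    archimedean          : ∀ x → ∃[ n ] x < n · 1#

  _≤_ : Rel Carrier ℓ₃
  x ≤ y = ¬ (y < x)

  -- |x - y| < ε
  Close : Carrier → Carrier → Carrier → Set ℓ₃
  Close ε x y = (- ε < x - y) × (x - y < ε)

  IsCauchy : (ℕ → Carrier) → Set (c ⊔ ℓ₃)
  IsCauchy s = ∀ ε → 0# < ε →
    ∃[ N ] (∀ k l → N ℕ.≤ k → N ℕ.≤ l → Close ε (s k) (s l))

  ConvergesTo : (ℕ → Carrier) → Carrier → Set (c ⊔ ℓ₃)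
  ConvergesTo s x = ∀ ε → 0# < ε →
    ∃[ N ] (∀ k → N ℕ.≤ k → Close ε (s k) x)

  field
    complete : ∀ s → IsCauchy s → ∃ (ConvergesTo s)

HasUniqueFixedPoint : ∀ {m} → Permutation′ m → Set
HasUniqueFixedPoint π = ∃! _≡_ (λ i → π ⟨$⟩ʳ i ≡ i)

-- The number of players is m = suc n ≥ 1.
module TwoAction {c ℓ₁ ℓ₂ ℓ₃} (R : Reals c ℓ₁ ℓ₂ ℓ₃) (n : ℕ) where

  open Reals R hiding (zero)

  Player : Set
  Player = Fin (suc n)

  -- Entry i of a profile is the index in {0,1} of player i's pure strategy.
  Profile : Set
  Profile = Vec (Fin 2) (suc n)

  -- A two-action game is given by its utilities U i.
  Game : Set c
  Game = Player → Profile → Carrier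

  Mixed : Set c
  Mixed = Vector Carrier (suc n)

  InCube : Mixed → Set ℓ₃
  InCube γ = ∀ i → (0# ≤ γ i) × (γ i ≤ 1#)

  sumProfiles : ∀ {k} → (Vec (Fin 2) k → Carrier) → Carrier
  sumProfiles {zero}  f = f []
  sumProfiles {suc k} f =
    sumProfiles (λ js → f (zero ∷ js)) + sumProfiles (λ js → f (suc zero ∷ js))

  prob : Carrier → Fin 2 → Carrier
  prob x zero       = 1# - x
  prob x (suc zero) = x

  V : Game → Player → Mixed → Carrier
  V U i γ = sumProfiles (λ js → product (λ k → prob (γ k) (lookup js k)) * U i js)

  -- The argument is γ⁻ⁱ, i.e. `removeAt γ i`.
  lam : Game → (i : Player) → Vector Carrier n → Carrier
  lam U i γ⁻ⁱ = V U i (insertAt γ⁻ⁱ i 1#) - V U i (insertAt γ⁻ⁱ i 0#)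

  record IsNash (U : Game) (γ : Mixed) : Set (ℓ₁ ⊔ ℓ₃) where
    field
      inCube   : InCube γ
      interior : ∀ i → 0# < γ i → γ i < 1# → lam U i (removeAt γ i) ≈ 0#
      at0      : ∀ i → γ i ≈ 0# → lam U i (removeAt γ i) ≤ 0#
      at1      : ∀ i → γ i ≈ 1# → 0# ≤ lam U i (removeAt γ i)

  -- `a i j` is a^i_j; the diagonal values a i i are unconstrained and unused.
  record ProductStructure (U : Game) : Set (c ⊔ ℓ₁ ⊔ ℓ₂ ⊔ ℓ₃) where
    field
      v          : Player → Fin 2
      a          : Player → Player → Carrier
      a-interior : ∀ i j → i ≢ j → (0# < a i j) × (a i j < 1#)
      a-distinct : ∀ i₁ i₂ j → i₁ ≢ i₂ → i₁ ≢ j → i₂ ≢ j → a i₁ j # a i₂ j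
      lam-product : ∀ i γ → InCube γ →
        lam U i (removeAt γ i)
          ≈ ((- 1#) ^ toℕ (v i)) * product (removeAt (λ j → γ j - a i j) i)

  module _ {U : Game} (P : ProductStructure U) where

    open ProductStructure P

    record EC (π : Permutation′ (suc n)) (γ : Mixed) : Set (ℓ₁ ⊔ ℓ₃) where
      field
        inCube : InCube γ
        L≡F    : ∀ i → (γ i ≈ 0# ⊎ γ i ≈ 1#) ⇔ (π ⟨$⟩ʳ i ≡ i)
        values : ∀ j → π ⟨$⟩ʳ j ≢ j → γ j ≈ a (π ⟨$⟩ʳ j) j

  _≋_ : Mixed → Mixed → Set ℓ₁
  γ ≋ δ = ∀ i → γ i ≈ δ i

  Distinct : Mixed → Mixed → Set ℓ₂
  Distinct γ δ = ∃[ i ] (γ i # δ i)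

  -- γ and δ are distinct and are all the elements of X.
  record ExactlyElements {ℓ} (X : Mixed → Set ℓ) (γ δ : Mixed) : Set (c ⊔ ℓ ⊔ ℓ₁ ⊔ ℓ₂) where
    field
      γ∈X        : X γ
      δ∈X        : X δ
      distinct   : Distinct γ δ
      exhaustive : ∀ ζ → X ζ → (ζ ≋ γ) ⊎ (ζ ≋ δ)

{-# OPTIONS --safe #-}

-- Let p be the fixed point of π.  An element of EC(π) is determined by its
-- p-th coordinate, which is 0 or 1.  A player i ≠ p is indifferent at both
-- points: with j = π⁻¹(i) ≠ i, the factor γ^j − a^i_j of λ^i vanishes.  For
-- player p, λ^p does not involve γ^p, so it has the same value Λ at both points;
-- every factor a^{π(j)}_j − a^p_j of Λ is apart from 0, since π(j) ≠ p.  Hence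
-- either Λ < 0 and only γ^p = 0 is an equilibrium, or Λ > 0 and only γ^p = 1 is.
module Submission where

open import Defs
open import Algebra.Bundles using (CommutativeRing)
import Algebra.Apartness.Properties.HeytingCommutativeRing as HeytingCommutativeRingProperties
import Algebra.Properties.Monoid.Sum as MonoidSum
import Algebra.Properties.Ring as RingProperties
open import Data.Fin.Base using (Fin; zero; suc; toℕ; punchIn; punchOut)
open import Data.Fin.Permutation using (Permutation′; _⟨$⟩ʳ_; _⟨$⟩ˡ_; inverseˡ; inverseʳ)
open import Data.Fin.Properties using (_≟_; punchInᵢ≢i; punchIn-punchOut)
open import Data.Nat.Base using (ℕ; suc)
open import Data.Product.Base using (_×_; _,_; ∃-syntax)
open import Data.Sum.Base using (_⊎_; inj₁; inj₂; [_,_]′)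
import Data.Sum.Base as Sum
open import Data.Vec.Functional using (Vector; removeAt; updateAt)
open import Data.Vec.Functional.Properties using (updateAt-updates; updateAt-minimal)
open import Function.Base using (_∘_; const)
open import Function.Bundles using (Equivalence; mk⇔)
open import Relation.Binary.PropositionalEquality as ≡ using (_≡_; _≢_)
open import Relation.Binary.Structures using (IsStrictPartialOrder)
open import Relation.Nullary.Decidable using (yes; no)
open import Relation.Nullary.Negation.Core using (¬_; contradiction)

module RealsProperties {c ℓ₁ ℓ₂ ℓ₃} (R : Reals c ℓ₁ ℓ₂ ℓ₃) where

  open Reals R hiding (zero)
  open CommutativeRing commutativeRing using (ring; *-monoid)
  open HeytingCommutativeRingProperties heytingCommutativeRing
  open RingProperties ring using (-‿involutive; -‿distribˡ-*)
  open IsStrictPartialOrder isStrictPartialOrder public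
    using (<-respˡ-≈; <-respʳ-≈) renaming (irrefl to <-irrefl; asym to <-asym)

  ≤-reflexive : ∀ {x y} → x ≈ y → x ≤ y
  ≤-reflexive x≈y = <-irrefl (sym x≈y)

  <⇒≤ : ∀ {x y} → x < y → x ≤ y
  <⇒≤ = <-asym

  ≤-respˡ-≈ : ∀ {x y z} → x ≈ y → x ≤ z → y ≤ z
  ≤-respˡ-≈ x≈y x≤z = x≤z ∘ <-respʳ-≈ (sym x≈y)

  ≤-respʳ-≈ : ∀ {x y z} → x ≈ y → z ≤ x → z ≤ y
  ≤-respʳ-≈ x≈y z≤x = z≤x ∘ <-respˡ-≈ (sym x≈y)

  #⇒<⊎> : ∀ {x y} → x # y → x < y ⊎ y < x
  #⇒<⊎> = Equivalence.to (#⇔<⊎> _ _)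

  -1*-1≈1 : - 1# * - 1# ≈ 1#
  -1*-1≈1 = trans (sym (-‿distribˡ-* 1# (- 1#)))
                  (trans (-‿cong (*-identityˡ (- 1#))) (-‿involutive 1#))

  -- Since `1#` is apart from `0#`, either `1# < 0#` or `0# < 1#`. In the first case `- 1#` is
  -- positive, hence so is its square, which is `1#`; this contradicts asymmetry.
  0<1 : 0# < 1#
  0<1 = [ (λ 1<0 → contradiction 1<0 (<-asym (1<0⇒0<1 1<0))) , (λ 0<1 → 0<1) ]′ (#⇒<⊎> 1#0)
    where
    1<0⇒0<1 : 1# < 0# → 0# < 1#
    1<0⇒0<1 1<0 = <-respʳ-≈ -1*-1≈1 (*-pos 0<-1 0<-1)
      where
      0<-1 : 0# < - 1#
      0<-1 = <-respˡ-≈ (-‿inverseʳ 1#) (<-respʳ-≈ (+-identityˡ (- 1#)) (+-monoˡ-< (- 1#) 1<0))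

  0≉1 : ¬ (0# ≈ 1#)
  0≉1 0≈1 = <-irrefl 0≈1 0<1

  -1#0 : - 1# # 0#
  -1#0 = invertibleˡ⇒# (- 1# , trans (*-congˡ (x-0≈x (- 1#))) -1*-1≈1)

  -- Apartness amounts to invertibility of the difference, and an inverse of `x - y` also inverts
  -- `(x - y) - 0#`.
  x#y⇒x-y#0 : ∀ {x y} → x # y → x - y # 0#
  x#y⇒x-y#0 {x} {y} x#y with z , z*[x-y]≈1 , _ ← #⇒invertible x#y =
    invertibleˡ⇒# (z , trans (*-congˡ (x-0≈x (x - y))) z*[x-y]≈1)

  x≈y⇒x-y≈0 : ∀ {x y} → x ≈ y → x - y ≈ 0#
  x≈y⇒x-y≈0 {y = y} x≈y = trans (+-congʳ x≈y) (-‿inverseʳ y)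

  x#0⇒x^n#0 : ∀ {x} n → x # 0# → x ^ n # 0#
  x#0⇒x^n#0 ℕ.zero    x#0 = 1#0
  x#0⇒x^n#0 (ℕ.suc n) x#0 = x#0y#0→xy#0 x#0 (x#0⇒x^n#0 n x#0)

  product-cong : ∀ {k} {xs ys : Vector Carrier k} → (∀ i → xs i ≈ ys i) → product xs ≈ product ys
  product-cong = MonoidSum.sum-cong-≋ *-monoid

  product#0 : ∀ {k} {xs : Vector Carrier k} → (∀ i → xs i # 0#) → product xs # 0#
  product#0 {ℕ.zero}  xs#0 = 1#0
  product#0 {ℕ.suc k} xs#0 = x#0y#0→xy#0 (xs#0 zero) (product#0 (xs#0 ∘ suc))

  product≈0 : ∀ {k} {xs : Vector Carrier k} i → xs i ≈ 0# → product xs ≈ 0#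
  product≈0 zero    x≈0 = trans (*-congʳ x≈0) (zeroˡ _)
  product≈0 (suc i) x≈0 = trans (*-congˡ (product≈0 i x≈0)) (zeroʳ _)

  product-removeAt≈0 : ∀ {k} (xs : Vector Carrier (suc k)) {i j} →
    i ≢ j → xs j ≈ 0# → product (removeAt xs i) ≈ 0#
  product-removeAt≈0 xs i≢j x≈0 =
    -- The vanishing factor survives the removal of index `i` and now sits at position
    -- `punchOut i≢j`.
    product≈0 (punchOut i≢j) (trans (reflexive (≡.cong xs (punchIn-punchOut i≢j))) x≈0)

module UniqueFixedPoint {c ℓ₁ ℓ₂ ℓ₃} (R : Reals c ℓ₁ ℓ₂ ℓ₃) (n : ℕ)
  {U : TwoAction.Game R n} (P : TwoAction.ProductStructure R n U)
  (π : Permutation′ (suc n)) (p : Fin (suc n))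
  (πp≡p : π ⟨$⟩ʳ p ≡ p) (p-unique : ∀ {i} → π ⟨$⟩ʳ i ≡ i → p ≡ i) where

  open TwoAction R n
  open Reals R hiding (zero)
  open RealsProperties R
  open HeytingCommutativeRingProperties heytingCommutativeRing using (x#0y#0→xy#0; 1#0; #-congʳ; #-congˡ)
  open ProductStructure P

  value : Mixed
  value j = a (π ⟨$⟩ʳ j) j

  -- At `p` the formula for `value` gives a diagonal entry of `a`, which is overwritten by `e`.
  -- Keeping `e` variable treats both points of EC(π) at once.
  vertex : Carrier → Mixed
  vertex e = updateAt value p (const e)

  Pure : Carrier → Set ℓ₁
  Pure x = x ≈ 0# ⊎ x ≈ 1#

  πj≢j : ∀ {j} → j ≢ p → π ⟨$⟩ʳ j ≢ j
  πj≢j j≢p = j≢p ∘ ≡.sym ∘ p-unique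

  -- Injectivity of π: the value `p` is already taken at `p` itself.
  πj≢p : ∀ {j} → j ≢ p → π ⟨$⟩ʳ j ≢ p
  πj≢p j≢p πj≡p = j≢p (≡.trans (≡.sym (inverseˡ π))
    (≡.trans (≡.cong (π ⟨$⟩ˡ_) (≡.trans πj≡p (≡.sym πp≡p))) (inverseˡ π)))

  vertex-p : ∀ {e} → vertex e p ≈ e
  vertex-p = reflexive (updateAt-updates p value)

  vertex-≢ : ∀ {e j} → j ≢ p → vertex e j ≈ value j
  vertex-≢ {j = j} j≢p = reflexive (updateAt-minimal j p value j≢p)

  value-interior : ∀ {j} → j ≢ p → (0# < value j) × (value j < 1#)
  value-interior j≢p = a-interior _ _ (πj≢j j≢p)

  -- Away from `p` the coordinates lie strictly between 0 and 1.
  vertex-pure⇒p : ∀ {e} i → Pure (vertex e i) → i ≡ p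
  vertex-pure⇒p i pure with i ≟ p
  ... | yes i≡p = i≡p
  ... | no i≢p with 0<x , x<1 ← value-interior i≢p = contradiction pure
    [ (λ x≈0 → <-irrefl (trans (sym x≈0) (vertex-≢ i≢p)) 0<x)
    , (λ x≈1 → <-irrefl (trans (sym (vertex-≢ i≢p)) x≈1) x<1) ]′

  pure-bounds : ∀ {e} → Pure e → (0# ≤ e) × (e ≤ 1#)
  pure-bounds (inj₁ e≈0) = ≤-reflexive (sym e≈0) , ≤-respˡ-≈ (sym e≈0) (<⇒≤ 0<1)
  pure-bounds (inj₂ e≈1) = ≤-respʳ-≈ (sym e≈1) (<⇒≤ 0<1) , ≤-reflexive e≈1

  vertex-inCube : ∀ {e} → Pure e → InCube (vertex e)
  vertex-inCube pure i with i ≟ p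
  ... | yes ≡.refl with 0≤e , e≤1 ← pure-bounds pure =
    ≤-respʳ-≈ (sym vertex-p) 0≤e , ≤-respˡ-≈ (sym vertex-p) e≤1
  ... | no i≢p with 0<x , x<1 ← value-interior i≢p =
    ≤-respʳ-≈ (sym (vertex-≢ i≢p)) (<⇒≤ 0<x) , ≤-respˡ-≈ (sym (vertex-≢ i≢p)) (<⇒≤ x<1)

  vertex∈EC : ∀ {e} → Pure e → EC P π (vertex e)
  vertex∈EC pure = record
    { inCube = vertex-inCube pure
    ; L≡F    = λ i → mk⇔
        (λ pureᵢ → ≡.subst (λ k → π ⟨$⟩ʳ k ≡ k) (≡.sym (vertex-pure⇒p i pureᵢ)) πp≡p)
        (λ πi≡i → ≡.subst (λ k → Pure (vertex _ k)) (p-unique πi≡i)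
                    (Sum.map (trans vertex-p) (trans vertex-p) pure))
    ; values = λ j πj≢j → vertex-≢ (λ j≡p → πj≢j (≡.subst (λ k → π ⟨$⟩ʳ k ≡ k) (≡.sym j≡p) πp≡p))
    }

  EC⇒vertex : ∀ {e ζ} → EC P π ζ → ζ p ≈ e → ζ ≋ vertex e
  EC⇒vertex ζ∈EC ζp≈e i with i ≟ p
  ... | yes ≡.refl = trans ζp≈e (sym vertex-p)
  ... | no i≢p = trans (EC.values ζ∈EC i (πj≢j i≢p)) (sym (vertex-≢ i≢p))

  EC-elements : ExactlyElements (EC P π) (vertex 0#) (vertex 1#)
  EC-elements = record
    { γ∈X        = vertex∈EC (inj₁ refl)
    ; δ∈X        = vertex∈EC (inj₂ refl)
    ; distinct   = p , #-sym (#-congʳ (sym vertex-p) (#-congˡ (sym vertex-p) 1#0))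
    -- As `p` is fixed by π, `L≡F` says that `ζ p` is 0 or 1, and this choice selects the vertex.
    ; exhaustive = λ ζ ζ∈EC → Sum.map (EC⇒vertex ζ∈EC) (EC⇒vertex ζ∈EC)
                                (Equivalence.from (EC.L≡F ζ∈EC p) πp≡p)
    }

  -- The common value of λ^p at both points. It is written with `value` instead of `vertex e`, since
  -- these differ at most in the removed coordinate `p`.
  Λ : Carrier
  Λ = ((- 1#) ^ toℕ (v p)) * product (removeAt (λ j → value j - a p j) p)

  Λ#0 : Λ # 0#
  Λ#0 = x#0y#0→xy#0 (x#0⇒x^n#0 (toℕ (v p)) -1#0) (product#0 λ k →
    let j≢p = punchInᵢ≢i p k in
    -- With j = `punchIn p k`, the factor compares the entries of rows π(j) and `p` in column j;
    -- these two rows and j are pairwise different.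
    x#y⇒x-y#0 (a-distinct _ p (punchIn p k) (πj≢p j≢p) (πj≢j j≢p) (j≢p ∘ ≡.sym)))

  lam-p : ∀ {e} → Pure e → lam U p (removeAt (vertex e) p) ≈ Λ
  lam-p pure = trans (lam-product p _ (vertex-inCube pure))
    (*-congˡ (product-cong λ k → +-congʳ (vertex-≢ (punchInᵢ≢i p k))))

  lam-≢ : ∀ {e i} → Pure e → i ≢ p → lam U i (removeAt (vertex e) i) ≈ 0#
  lam-≢ {e} {i} pure i≢p = trans (lam-product i _ (vertex-inCube pure))
    (trans (*-congˡ (product-removeAt≈0 (λ k → vertex e k - a i k) i≢π⁻¹i
                      (x≈y⇒x-y≈0 vertex-π⁻¹i)))
           (zeroʳ _))
    where
    j : Player
    j = π ⟨$⟩ˡ i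

    i≢π⁻¹i : i ≢ j
    i≢π⁻¹i i≡j = πj≢j i≢p (≡.trans (≡.cong (π ⟨$⟩ʳ_) i≡j) (inverseʳ π))

    j≢p : j ≢ p
    j≢p j≡p = i≢p (≡.trans (≡.sym (inverseʳ π)) (≡.trans (≡.cong (π ⟨$⟩ʳ_) j≡p) πp≡p))

    -- The coordinate at `j` is taken from row π(j), which is `i` by the choice of `j`.
    vertex-π⁻¹i : vertex e j ≈ a i j
    vertex-π⁻¹i = trans (vertex-≢ j≢p) (reflexive (≡.cong (λ k → a k j) (inverseʳ π)))

  -- Every player other than `p` has λ equal to 0, which meets all three conditions, so only the
  -- sign of `Λ` matters. For each pure `e` one of the two sign hypotheses is vacuous, because 0 and
  -- 1 differ.
  vertex-nash : ∀ {e} → Pure e → (e ≈ 0# → Λ ≤ 0#) → (e ≈ 1# → 0# ≤ Λ) → IsNash U (vertex e)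
  vertex-nash {e} pure Λ≤0 0≤Λ = record
    { inCube   = vertex-inCube pure
    ; interior = interior
    ; at0      = at0
    ; at1      = at1
    }
    where
    interior : ∀ i → 0# < vertex e i → vertex e i < 1# → lam U i (removeAt (vertex e) i) ≈ 0#
    interior i 0<x x<1 with i ≟ p
    ... | no i≢p     = lam-≢ pure i≢p
    -- The coordinate at `p` is 0 or 1, so the interior condition does not arise.
    ... | yes ≡.refl = contradiction pure
      [ (λ e≈0 → <-irrefl (sym (trans vertex-p e≈0)) 0<x)
      , (λ e≈1 → <-irrefl (trans vertex-p e≈1) x<1) ]′

    at0 : ∀ i → vertex e i ≈ 0# → lam U i (removeAt (vertex e) i) ≤ 0#
    at0 i x≈0 with i ≟ p
    ... | no i≢p     = ≤-reflexive (lam-≢ pure i≢p)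
    ... | yes ≡.refl = ≤-respˡ-≈ (sym (lam-p pure)) (Λ≤0 (trans (sym vertex-p) x≈0))

    at1 : ∀ i → vertex e i ≈ 1# → 0# ≤ lam U i (removeAt (vertex e) i)
    at1 i x≈1 with i ≟ p
    ... | no i≢p     = ≤-reflexive (sym (lam-≢ pure i≢p))
    ... | yes ≡.refl = ≤-respʳ-≈ (sym (lam-p pure)) (0≤Λ (trans (sym vertex-p) x≈1))

  nash-0⇒Λ≤0 : IsNash U (vertex 0#) → Λ ≤ 0#
  nash-0⇒Λ≤0 nash = ≤-respˡ-≈ (lam-p (inj₁ refl)) (IsNash.at0 nash p vertex-p)

  nash-1⇒0≤Λ : IsNash U (vertex 1#) → 0# ≤ Λ
  nash-1⇒0≤Λ nash = ≤-respʳ-≈ (lam-p (inj₂ refl)) (IsNash.at1 nash p vertex-p)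

  exactly-one-nash : (IsNash U (vertex 0#) × ¬ IsNash U (vertex 1#))
                   ⊎ (¬ IsNash U (vertex 0#) × IsNash U (vertex 1#))
  exactly-one-nash = Sum.map
    -- Since `0# ≤ Λ` means that `Λ < 0#` is impossible, `Λ<0` directly refutes an equilibrium at
    -- `vertex 1#`; the other case is symmetric.
    (λ Λ<0 → vertex-nash (inj₁ refl) (λ _ → <⇒≤ Λ<0) (λ 0≈1 → contradiction 0≈1 0≉1)
           , λ nash → nash-1⇒0≤Λ nash Λ<0)
    (λ 0<Λ → (λ nash → nash-0⇒Λ≤0 nash 0<Λ)
           , vertex-nash (inj₂ refl) (λ 1≈0 → contradiction (sym 1≈0) 0≉1) (λ _ → <⇒≤ 0<Λ))
    (#⇒<⊎> Λ#0)

theorem3p7 : ∀ {c ℓ₁ ℓ₂ ℓ₃} (R : Reals c ℓ₁ ℓ₂ ℓ₃) (n : ℕ) → let open TwoAction R n in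
    (U : Game) (P : ProductStructure U) (π : Permutation′ (suc n)) → HasUniqueFixedPoint π →
    ∃[ γ ] ∃[ δ ] (ExactlyElements (EC P π) γ δ
    × ((IsNash U γ × ¬ IsNash U δ) ⊎ (¬ IsNash U γ × IsNash U δ)))
theorem3p7 R n U P π (p , πp≡p , p-unique) =
  vertex 0# , vertex 1# , EC-elements , exactly-one-nash
  where
  open Reals R using (0#; 1#)
  open UniqueFixedPoint R n P π p πp≡p p-unique
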